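{- There is a partition of the variables of the set disjointness function $\mathrm{DISJ}_n$ between Alice and Bob such that, with respect to this partition, $\mathrm{DISJ}_n$ has a real communication protocol of size $O(n)$, but any real communication protocol computing $\mathrm{DISJ}_n$ requires $\Omega((n\log n)^{1/5})$ rounds of communication.
   Context: Set disjointness: $\mathrm{DISJ}_n=\mathrm{OR}_n\circ\mathrm{AND}_2^n:\{0,1\}^{2n}\to\{0,1\}$, i.e. $\mathrm{DISJ}_n(x,y)=\bigvee_{i=1}^n(x_i\wedge y_i)$, where $\mathrm{OR}_n$ is the $n$-bit OR function and $\mathrm{AND}_2$ the 2-bit AND function. Real communication: Alice receives $x$ (her part of the input) and Bob receives $y$ (his part). They communicate via a referee: in each round Alice and Bob send real numbers $r_A$, $r_B$ (each depending on the player's own input and on the referee's previous answers) to the referee, who announces a single bit to both players, equal to $1$ if $r_A>r_B$ and $0$ otherwise. A protocol is thus a binary tree whose leaves are labelled by outputs; it computes a function $f$ if for every input the leaf reached is labelled with the value of $f$. The number of rounds is the depth of the protocol tree (the worst case over inputs), and the size is the number of nodes in the protocol tree. -}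

module Defs where

open import Data.Bool.Base using (Bool; false; _∧_; _∨_)
open import Data.Fin.Base using (Fin)
open import Data.Nat.Base as ℕ using (ℕ)
open import Data.Product.Base using (∃-syntax; _×_)
open import Data.Rational.Base using (ℚ; _<_)
open import Data.Sum.Base using (_⊎_; inj₁; inj₂)
open import Data.Vec.Functional using (Vector; foldr)
open import Function.Bundles using (_⇔_)
open import Relation.Binary.PropositionalEquality.Core using (_≡_)
open import Relation.Nullary.Negation.Core using (¬_)

-- Two-sided Dedekind cuts: Lower q means q < x, and Upper q means x < q.
record ℝ : Set₁ where
  field
    Lower Upper     : ℚ → Set
    lower-inhabited : ∃[ q ] Lower q
    upper-inhabited : ∃[ q ] Upper q
    lower-rounded   : ∀ q → Lower q ⇔ (∃[ r ] q < r × Lower r)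
    upper-rounded   : ∀ q → Upper q ⇔ (∃[ r ] r < q × Upper r)
    disjoint        : ∀ q → ¬ (Lower q × Upper q)
    located         : ∀ {q r} → q < r → Lower q ⊎ Upper r

infix 4 _>ᴿ_

_>ᴿ_ : ℝ → ℝ → Set
x >ᴿ y = ∃[ q ] ℝ.Upper y q × ℝ.Lower x q

-- In  ask rA rB P₁ P₀  the players continue with P₁ after the referee
-- announces 1, and with P₀ after the referee announces 0.
data Protocol (A B : Set) : Set₁ where
  leaf : Bool → Protocol A B
  ask  : (A → ℝ) → (B → ℝ) → (P₁ P₀ : Protocol A B) → Protocol A B

module _ {A B : Set} where

  size : Protocol A B → ℕ
  size (leaf _)         = 1
  size (ask _ _ P₁ P₀) = 1 ℕ.+ (size P₁ ℕ.+ size P₀)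

  rounds : Protocol A B → ℕ
  rounds (leaf _)         = 0
  rounds (ask _ _ P₁ P₀) = 1 ℕ.+ (rounds P₁ ℕ.⊔ rounds P₀)

  -- Outputs P a b o : on inputs a and b, the leaf of P that is reached is
  -- labelled o.  This is a relation rather than a function because the order
  -- of the reals is not decidable constructively.
  data Outputs : Protocol A B → A → B → Bool → Set₁ where
    at-leaf : ∀ {a b o} → Outputs (leaf o) a b o
    on-1    : ∀ {rA rB P₁ P₀ a b o} → rA a >ᴿ rB b →
              Outputs P₁ a b o → Outputs (ask rA rB P₁ P₀) a b o
    on-0    : ∀ {rA rB P₁ P₀ a b o} → ¬ (rA a >ᴿ rB b) →
              Outputs P₀ a b o → Outputs (ask rA rB P₁ P₀) a b o

data Player : Set where
  alice bob : Player

Partition : Set → Set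
Partition V = V → Player

Input : {V : Set} → Partition V → Player → Set
Input {V} π p = (v : V) → π v ≡ p → Bool

merge : {V : Set} (π : Partition V) → Input π alice → Input π bob → V → Bool
merge π a b v with π v in eq
... | alice = a v eq
... | bob   = b v eq

RealProtocol : {V : Set} → Partition V → Set₁
RealProtocol π = Protocol (Input π alice) (Input π bob)

Computes : {V : Set} (π : Partition V) →
           RealProtocol π → ((V → Bool) → Bool) → Set₁
Computes π P f = ∀ a b → Outputs P a b (f (merge π a b))

OR : ∀ {n} → Vector Bool n → Bool
OR = foldr _∨_ false

-- inj₁ i is the variable xᵢ and inj₂ i is the variable yᵢ.
Var : ℕ → Set
Var n = Fin n ⊎ Fin n

DISJ : ∀ n → (Var n → Bool) → Bool
DISJ n z = OR λ i → z (inj₁ i) ∧ z (inj₂ i)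

{-# OPTIONS --safe #-}
module Submission where

-- Upper bound: compare x_i with 1 - y_i for i = 1, 2, ...
--
-- Lower bound, in the style of Raz and McKenzie: split [n] into k blocks of
-- size m, let Alice hold one point of each block (a vector in [m]^k) and Bob an
-- arbitrary subset of each block, and let an adversary answer so that the sets
-- stay disjoint.  It keeps a rectangle A × B of surviving inputs on ℓ live
-- blocks, where every projection of A that forgets one block is smaller than A
-- by at least a factor d.  A real comparison sorts the rows of the rectangle into a
-- chain, so it is constant on a subrectangle with half of the rows and half of
-- the columns.  Deleting light fibres then makes every nonempty fibre of A
-- have at least τ points, at the cost of another factor 2.  If forgetting block i now
-- loses less than the factor d, then block i is forgotten: by a union bound,
-- most values w of Bob's block contain, for every remaining pointer vector, a
-- zero at some admissible pointer, so Bob can be fixed to such a w and block i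
-- made disjoint.  The density of A in [m]^ℓ grows by m / d ≥ 4 on each such
-- step and drops by at most 4 in each round, so fewer than k rounds leave a
-- live block, and then both outputs are still possible.  With k = 2^a and
-- m = 2^(3a + 8) this gives k rounds on n ≈ k⁴ points, which is more than
-- needed.

open import Defs
open import Data.Bool using (Bool; true; false; not; _∧_; _∨_; if_then_else_)
open import Data.Bool.Properties
  using (∧-zeroʳ; ∧-identityʳ; ∨-zeroʳ; not-involutive; T-≡; ⇔→≡)
  renaming (_≟_ to _≟ᵇ_)
open import Data.Empty using (⊥; ⊥-elim)
open import Data.Fin as Fin
  using (Fin; zero; suc; fromℕ<; splitAt; _↑ˡ_; remQuot)
open import Data.Fin.Properties using (any?; splitAt-↑ˡ; remQuot-combine)
open import Data.List
  using (List; []; _∷_; length; map; allFin; cartesianProductWith; _++_)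
open import Data.List.Membership.Propositional using (_∈_)
open import Data.List.Membership.Propositional.Properties
  using (∈-allFin; ∈-cartesianProductWith⁺)
open import Data.List.Properties using (map-tabulate; map-∘; map-++; length-tabulate)
open import Data.List.Relation.Unary.Any using (here; there)
open import Data.Nat
open import Data.Nat.ListAction using (sum)
open import Data.Nat.ListAction.Properties using (sum-++)
open import Data.Nat.Logarithm using (⌈log₂_⌉; ⌈log₂⌉-mono-≤; ⌈log₂2^n⌉≡n)
open import Data.Nat.Properties
open import Data.Nat.Tactic.RingSolver using (solve-∀)
open import Data.Product using (Σ-syntax; ∃-syntax; _×_; _,_; proj₁; proj₂)
open import Data.Rational as ℚ using (ℚ; 0ℚ; 1ℚ)
import Data.Rational.Properties as ℚ
open import Data.Sum using (_⊎_; inj₁; inj₂; [_,_]′)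
open import Data.Unit using (⊤; tt)
open import Data.Vec using (Vec; []; _∷_; insertAt; removeAt; lookup)
open import Data.Vec.Properties using (removeAt-insertAt)
open import Function.Bundles using (Equivalence; mk⇔)
open import Relation.Binary.Definitions using (tri<; tri≈; tri>)
open import Relation.Binary.PropositionalEquality
open import Relation.Nullary using (¬_; yes; no; does; contradiction; from-yes)
open import Relation.Nullary.Decidable using (dec-true)

open Equivalence using (to; from)

n+n≡2*n : ∀ n → n + n ≡ 2 * n
n+n≡2*n = solve-∀

-- Finite sums

opaque

  ∑ : {X : Set} → List X → (X → ℕ) → ℕ
  ∑ xs f = sum (map f xs)

  ∑-cong : {X : Set} {f g : X → ℕ} (xs : List X) → (∀ x → f x ≡ g x) → ∑ xs f ≡ ∑ xs g
  ∑-cong []       eq = refl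
  ∑-cong (x ∷ xs) eq = cong₂ _+_ (eq x) (∑-cong xs eq)

  ∑-mono : {X : Set} {f g : X → ℕ} (xs : List X) → (∀ x → f x ≤ g x) → ∑ xs f ≤ ∑ xs g
  ∑-mono []       le = z≤n
  ∑-mono (x ∷ xs) le = +-mono-≤ (le x) (∑-mono xs le)

  ∑-strict : {X : Set} {f g : X → ℕ} {xs : List X} {x : X} → (∀ x → f x ≤ g x) →
             x ∈ xs → f x < g x → ∑ xs f < ∑ xs g
  ∑-strict {xs = _ ∷ xs} le (here refl)  lt = +-mono-<-≤ lt (∑-mono xs le)
  ∑-strict               le (there x∈xs) lt = +-mono-≤-< (le _) (∑-strict le x∈xs lt)

  ∑-+ : {X : Set} (xs : List X) (f g : X → ℕ) → ∑ xs (λ x → f x + g x) ≡ ∑ xs f + ∑ xs g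
  ∑-+ []       f g = refl
  ∑-+ (x ∷ xs) f g = trans (cong (f x + g x +_) (∑-+ xs f g))
                           (interchange (f x) (g x) (∑ xs f) (∑ xs g))
    where
    interchange : ∀ a b c d → a + b + (c + d) ≡ a + c + (b + d)
    interchange = solve-∀

  ∑-* : {X : Set} (xs : List X) (f : X → ℕ) (c : ℕ) → ∑ xs (λ x → f x * c) ≡ ∑ xs f * c
  ∑-* []       f c = refl
  ∑-* (x ∷ xs) f c = trans (cong (f x * c +_) (∑-* xs f c))
                           (sym (*-distribʳ-+ c (f x) (∑ xs f)))

  ∑-const : {X : Set} (xs : List X) (c : ℕ) → ∑ xs (λ _ → c) ≡ length xs * c
  ∑-const []       c = refl
  ∑-const (x ∷ xs) c = cong (c +_) (∑-const xs c)

  ∑-≤-length : {X : Set} {f : X → ℕ} (xs : List X) {c : ℕ} → (∀ x → f x ≤ c) →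
               ∑ xs f ≤ length xs * c
  ∑-≤-length xs {c} le = ≤-trans (∑-mono xs le) (≤-reflexive (∑-const xs c))

  ≤-∑ : {X : Set} {xs : List X} {x : X} (f : X → ℕ) → x ∈ xs → f x ≤ ∑ xs f
  ≤-∑ f (here refl)  = m≤m+n _ _
  ≤-∑ f (there x∈xs) = m≤n⇒m≤o+n _ (≤-∑ f x∈xs)

  ∑-pigeonhole : {X : Set} (f g : X → ℕ) (xs : List X) → ∑ xs g < ∑ xs f →
                 ∃[ x ] x ∈ xs × g x < f x
  ∑-pigeonhole f g (x ∷ xs) lt with g x <? f x
  ... | yes gx<fx = x , here refl , gx<fx
  ... | no  gx≮fx with y , y∈xs , gy<fy ← ∑-pigeonhole f g xs (≰⇒> λ le →
                         <⇒≱ lt (+-mono-≤ (≮⇒≥ gx≮fx) le))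
                    = y , there y∈xs , gy<fy

  ∑-exchange : {I : Set} {js : List I} {j : I} {p q : I → ℕ} → (∀ i → q i ≤ p i) → j ∈ js →
               ∑ js q + p j ≤ ∑ js p + q j
  ∑-exchange {js = j ∷ js} {p = p} {q} q≤p (here refl) =
    ≤-trans (+-monoˡ-≤ (p j) (+-monoʳ-≤ (q j) (∑-mono js q≤p)))
            (≤-reflexive (swap (q j) (∑ js p) (p j)))
    where
    swap : ∀ a b c → a + b + c ≡ c + b + a
    swap = solve-∀
  ∑-exchange {js = i ∷ js} {p = p} {q} q≤p (there j∈) =
    ≤-trans (≤-reflexive (+-assoc (q i) _ _))
    (≤-trans (+-mono-≤ (q≤p i) (∑-exchange q≤p j∈)) (≤-reflexive (sym (+-assoc (p i) _ _))))

  ∑-swap : {X Y : Set} (xs : List X) (ys : List Y) (f : X → Y → ℕ) →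
           ∑ xs (λ x → ∑ ys (f x)) ≡ ∑ ys (λ y → ∑ xs (λ x → f x y))
  ∑-swap []       ys f = sym (trans (∑-const ys 0) (*-zeroʳ (length ys)))
  ∑-swap (x ∷ xs) ys f = trans (cong (∑ ys (f x) +_) (∑-swap xs ys f))
                               (sym (∑-+ ys (f x) _))

  ∑-++ : {X : Set} (xs ys : List X) (f : X → ℕ) → ∑ (xs ++ ys) f ≡ ∑ xs f + ∑ ys f
  ∑-++ xs ys f = trans (cong sum (map-++ f xs ys)) (sum-++ (map f xs) (map f ys))

  ∑-map : {X Y : Set} (g : Y → X) (ys : List Y) (f : X → ℕ) →
          ∑ (map g ys) f ≡ ∑ ys (λ y → f (g y))
  ∑-map g ys f = cong sum (sym (map-∘ ys))

  ∑-product : {X Y Z : Set} (_∙_ : X → Y → Z) (xs : List X) (ys : List Y) (f : Z → ℕ) →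
              ∑ (cartesianProductWith _∙_ xs ys) f ≡ ∑ xs (λ x → ∑ ys (λ y → f (x ∙ y)))
  ∑-product _∙_ []       ys f = refl
  ∑-product _∙_ (x ∷ xs) ys f =
    trans (∑-++ (map (x ∙_) ys) _ f) (cong₂ _+_ (∑-map (x ∙_) ys f) (∑-product _∙_ xs ys f))

  ∑-allFin : ∀ m (f : Fin (suc m) → ℕ) →
             ∑ (allFin (suc m)) f ≡ f zero + ∑ (allFin m) (λ j → f (suc j))
  ∑-allFin m f = cong (λ js → f zero + sum js)
    (trans (map-tabulate suc f) (sym (map-tabulate (λ j → j) (λ j → f (suc j)))))

  ∑-[] : {X : Set} (f : X → ℕ) → ∑ [] f ≡ 0
  ∑-[] f = refl

  ∑-[x] : {X : Set} (x : X) (f : X → ℕ) → ∑ (x ∷ []) f ≡ f x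
  ∑-[x] x f = +-identityʳ (f x)

  ∑-[x,y] : {X : Set} (x y : X) (f : X → ℕ) → ∑ (x ∷ y ∷ []) f ≡ f x + f y
  ∑-[x,y] x y f = cong (f x +_) (+-identityʳ (f y))

-- Enumerations of vectors, and insertion of a coordinate.

vecs : {X : Set} → List X → ∀ n → List (Vec X n)
vecs xs zero    = [] ∷ []
vecs xs (suc n) = cartesianProductWith _∷_ xs (vecs xs n)

∈-vecs : {X : Set} {xs : List X} → (∀ x → x ∈ xs) → ∀ {n} (v : Vec X n) → v ∈ vecs xs n
∈-vecs all []      = here refl
∈-vecs all (x ∷ v) = ∈-cartesianProductWith⁺ _∷_ (all x) (∈-vecs all v)

module _ {X : Set} (xs : List X) where

  length-vecs : ∀ n → length (vecs xs n) ≡ length xs ^ n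
  length-vecs n = trans (trans (sym (*-identityʳ _)) (sym (∑-const (vecs xs n) 1))) (go n)
    where
    go : ∀ n → ∑ (vecs xs n) (λ _ → 1) ≡ length xs ^ n
    go zero    = ∑-[x] [] _
    go (suc n) = trans (∑-product _∷_ xs (vecs xs n) _)
      (trans (∑-const xs _) (cong (length xs *_) (go n)))

  ∑-insertAt : ∀ {n} (i : Fin (suc n)) (f : Vec X (suc n) → ℕ) →
               ∑ (vecs xs (suc n)) f ≡
               ∑ (vecs xs n) (λ v → ∑ xs (λ x → f (insertAt v i x)))
  ∑-insertAt {n} zero    f =
    trans (∑-product _∷_ xs (vecs xs n) f) (∑-swap xs (vecs xs n) (λ x v → f (x ∷ v)))
  ∑-insertAt {suc n} (suc i) f =
    trans (∑-product _∷_ xs (vecs xs (suc n)) f)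
    (trans (∑-cong xs (λ x → ∑-insertAt i (λ v → f (x ∷ v))))
           (sym (∑-product _∷_ xs (vecs xs n) _)))

-- The new positions depend on `i` and `i′` alone, so one reindexing serves all points of a fibre,
-- as `thick-proj` requires.
insertAt-comm : ∀ {n} (i : Fin (suc (suc n))) (i′ : Fin (suc n)) →
  ∃[ p ] ∃[ p′ ] (∀ {X : Set} (v : Vec X n) (x x′ : X) →
    insertAt (insertAt v i′ x′) i x ≡ insertAt (insertAt v p′ x) p x′)
insertAt-comm zero    i′      = suc i′ , zero , λ v x x′ → refl
insertAt-comm (suc i) zero    = zero , i , λ v x x′ → refl
insertAt-comm {suc n} (suc i) (suc i′) with p , p′ , eq ← insertAt-comm i i′ =
  suc p , suc p′ , λ { (y ∷ v) x x′ → cong (y ∷_) (eq v x x′) }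

insertAt-surjective : ∀ {n} {X : Set} (i : Fin (suc n)) (v : Vec X (suc n)) →
                      ∃[ u ] ∃[ x ] insertAt u i x ≡ v
insertAt-surjective zero (x ∷ v) = v , x , refl
insertAt-surjective {suc n} (suc i) (y ∷ v) with u , x , eq ← insertAt-surjective i v =
  y ∷ u , x , cong (y ∷_) eq

-- Counting

_⊆_ : {X : Set} → (X → Bool) → (X → Bool) → Set
A ⊆ B = ∀ x → A x ≡ true → B x ≡ true

𝟙 : Bool → ℕ
𝟙 b = if b then 1 else 0

𝟙≤1 : ∀ b → 𝟙 b ≤ 1
𝟙≤1 true  = ≤-refl
𝟙≤1 false = z≤n

𝟙-mono : ∀ {b c} → (b ≡ true → c ≡ true) → 𝟙 b ≤ 𝟙 c
𝟙-mono {false} _ = z≤n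
𝟙-mono {true}  h rewrite h refl = ≤-refl

𝟙>0 : ∀ {b} → 0 < 𝟙 b → b ≡ true
𝟙>0 {true} _ = refl

# : {X : Set} → List X → (X → Bool) → ℕ
# xs A = ∑ xs (λ x → 𝟙 (A x))

module _ {X : Set} where

  #-mono : {A B : X → Bool} (xs : List X) → A ⊆ B → # xs A ≤ # xs B
  #-mono xs A⊆B = ∑-mono xs (λ x → 𝟙-mono (A⊆B x))

  #-strict : {A B : X → Bool} {xs : List X} {x : X} → A ⊆ B →
             x ∈ xs → A x ≡ false → B x ≡ true → # xs A < # xs B
  #-strict {A} {B} A⊆B x∈xs ¬Ax Bx =
    ∑-strict (λ x → 𝟙-mono (A⊆B x)) x∈xs
      (subst₂ (λ b c → 𝟙 b < 𝟙 c) (sym ¬Ax) (sym Bx) ≤-refl)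

  #≤length : (xs : List X) (A : X → Bool) → # xs A ≤ length xs
  #≤length xs A = ≤-trans (∑-≤-length xs (λ x → 𝟙≤1 (A x))) (≤-reflexive (*-identityʳ _))

  #-split : (xs : List X) (A C : X → Bool) →
            # xs A ≡ # xs (λ x → A x ∧ C x) + # xs (λ x → A x ∧ not (C x))
  #-split xs A C = trans (∑-cong xs (λ x → split (A x) (C x))) (∑-+ xs _ _)
    where
    split : ∀ a c → 𝟙 a ≡ 𝟙 (a ∧ c) + 𝟙 (a ∧ not c)
    split false c     = refl
    split true  false = refl
    split true  true  = refl

  #>0 : {xs : List X} {A : X → Bool} → 0 < # xs A → ∃[ x ] A x ≡ true
  #>0 {xs} {A} pos with x , _ , lt ← ∑-pigeonhole (λ x → 𝟙 (A x)) (λ _ → 0) xs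
                         (subst (_< # xs A) (sym (trans (∑-const xs 0) (*-zeroʳ (length xs)))) pos)
                   = x , 𝟙>0 lt

  #-pos : {xs : List X} {A : X → Bool} {x : X} → x ∈ xs → A x ≡ true → 0 < # xs A
  #-pos {xs} {A} {x} x∈xs Ax =
    ≤-trans (≤-reflexive (cong 𝟙 (sym Ax))) (≤-∑ (λ x → 𝟙 (A x)) x∈xs)

∧-true : ∀ {a b} → a ∧ b ≡ true → a ≡ true × b ≡ true
∧-true {true} {true} _ = refl , refl

true-or-false : ∀ b → b ≡ true ⊎ b ≡ false
true-or-false true  = inj₁ refl
true-or-false false = inj₂ refl

true≢false : ∀ {b} → b ≡ true → b ≡ false → ⊥
true≢false refl ()

≤⇒≤ᵇ-true : ∀ {m n} → m ≤ n → (m ≤ᵇ n) ≡ true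
≤⇒≤ᵇ-true m≤n = to T-≡ (≤⇒≤ᵇ m≤n)

≤ᵇ-true⇒≤ : ∀ {m n} → (m ≤ᵇ n) ≡ true → m ≤ n
≤ᵇ-true⇒≤ h = ≤ᵇ⇒≤ _ _ (from T-≡ h)

-- Nested comparisons are constant on half of the rows and half of the columns

minimiser : {X : Set} (f : X → ℕ) (A : X → Bool) (xs : List X) →
  (∀ {x} → x ∈ xs → A x ≡ false) ⊎
  (∃[ m ] A m ≡ true × (∀ {x} → x ∈ xs → A x ≡ true → f m ≤ f x))
minimiser f A [] = inj₁ λ ()
minimiser f A (y ∷ xs) with true-or-false (A y) | minimiser f A xs
... | inj₂ ¬Ay | inj₁ none = inj₁ λ { (here refl) → ¬Ay ; (there x∈) → none x∈ }
... | inj₂ ¬Ay | inj₂ (m , Am , min) =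
  inj₂ (m , Am , λ { (here refl) Ax → contradiction Ax (λ Ay → true≢false Ay ¬Ay)
                   ; (there x∈) Ax → min x∈ Ax })
... | inj₁ Ay | inj₁ none =
  inj₂ (y , Ay , λ { (here refl) Ax → ≤-refl
                   ; (there x∈) Ax → ⊥-elim (true≢false Ax (none x∈)) })
... | inj₁ Ay | inj₂ (m , Am , min) with ≤-total (f y) (f m)
...   | inj₁ fy≤fm = inj₂ (y , Ay , λ { (here refl) Ax → ≤-refl
                                      ; (there x∈) Ax → ≤-trans fy≤fm (min x∈ Ax) })
...   | inj₂ fm≤fy = inj₂ (m , Am , λ { (here refl) Ax → fm≤fy
                                      ; (there x∈) Ax → min x∈ Ax })

half-of-sum : ∀ {s} p q → s ≡ p + q → s ≤ 2 * p ⊎ s ≤ 2 * q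
half-of-sum p q refl with ≤-total p q
... | inj₁ p≤q = inj₂ (≤-trans (+-monoˡ-≤ q p≤q) (≤-reflexive (n+n≡2*n q)))
... | inj₂ q≤p = inj₁ (≤-trans (+-monoʳ-≤ p q≤p) (≤-reflexive (n+n≡2*n p)))

module Halving {V W : Set} {vs : List V} {ws : List W}
  (all-vs : ∀ v → v ∈ vs) (all-ws : ∀ w → w ∈ ws)
  (A : V → Bool) (B : W → Bool) where

  -- Excludes the pattern in which `a` beats `a′` in one column and loses to it in another, so the
  -- rows within `B` form a chain under inclusion. Only the rectangle is constrained, because off it
  -- the comparison will carry a default value.
  Nested : (V → W → Bool) → Set
  Nested cmp = ∀ {a a′ b b′} → A a ≡ true → A a′ ≡ true → B b ≡ true → B b′ ≡ true →
    cmp a b ≡ true → cmp a′ b ≡ false → cmp a′ b′ ≡ true → cmp a b′ ≡ true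

  -- Negation turns a forbidden pattern into one with the two columns exchanged.
  nested-not : ∀ {cmp} → Nested cmp → Nested (λ a b → not (cmp a b))
  nested-not {cmp} nested {a} {a′} {b} {b′} Aa Aa′ Bb Bb′ p q r
    with cmp a b in e₁ | cmp a′ b in e₂ | cmp a b′ in e₃ | cmp a′ b′ in e₄
  nested-not nested Aa Aa′ Bb Bb′ p q r | false | true | false | false = refl
  nested-not nested Aa Aa′ Bb Bb′ p q r | false | true | true  | false =
    contradiction (nested Aa Aa′ Bb′ Bb e₃ e₄ e₂) (λ e → true≢false e e₁)

  ConstantHalf : (V → W → Bool) → Bool → Set
  ConstantHalf cmp o = Σ[ A′ ∈ (V → Bool) ] Σ[ B′ ∈ (W → Bool) ]
    A′ ⊆ A × B′ ⊆ B × # vs A ≤ 2 * # vs A′ × # ws B ≤ 2 * # ws B′ ×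
    (∀ {a b} → A′ a ≡ true → B′ b ≡ true → cmp a b ≡ o)

  row : (V → W → Bool) → V → W → Bool
  row cmp a b = B b ∧ cmp a b

  manyRow : (V → W → Bool) → V → Bool
  manyRow cmp a = # ws B ≤ᵇ 2 * # ws (row cmp a)

  -- The rows are nested, so the smallest of the large rows lies in all of them.
  half-true : ∀ {cmp} → Nested cmp →
              # vs A ≤ 2 * # vs (λ a → A a ∧ manyRow cmp a) → ConstantHalf cmp true
  half-true {cmp} nested half
    with minimiser (λ a → # ws (row cmp a)) (λ a → A a ∧ manyRow cmp a) vs
  ... | inj₁ none =
    _ , B , (λ a h → proj₁ (∧-true h)) , (λ b h → h) , half , m≤n*m _ 2 ,
    λ h _ → ⊥-elim (true≢false h (none (all-vs _)))
  ... | inj₂ (m , Hm , min) =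
    _ , row cmp m , (λ a h → proj₁ (∧-true h)) , (λ b h → proj₁ (∧-true h)) , half ,
    ≤ᵇ-true⇒≤ (proj₂ (∧-true Hm)) , const
    where
    const : ∀ {a b} → A a ∧ manyRow cmp a ≡ true → row cmp m b ≡ true → cmp a b ≡ true
    const {a} {b} Ha Rb with true-or-false (cmp a b)
    ... | inj₁ yes-ab = yes-ab
    ... | inj₂ no-ab  = contradiction (min (all-vs a) Ha) (<⇒≱ smaller)
      where
      Bb    = proj₁ (∧-true Rb)
      mb    = proj₂ (∧-true Rb)
      row⊆  : row cmp a ⊆ row cmp m
      row⊆ b′ h with Bb′ , ab′ ← ∧-true h =
        cong₂ _∧_ Bb′ (nested (proj₁ (∧-true Hm)) (proj₁ (∧-true Ha)) Bb Bb′ mb no-ab ab′)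
      smaller : # ws (row cmp a) < # ws (row cmp m)
      smaller = #-strict row⊆ (all-ws b) (trans (cong (B b ∧_) no-ab) (∧-zeroʳ (B b))) Rb

  few⇒many : ∀ cmp → (λ a → A a ∧ not (manyRow cmp a)) ⊆
                     (λ a → A a ∧ manyRow (λ a b → not (cmp a b)) a)
  few⇒many cmp a h
    with half-of-sum (# ws (row cmp a)) (# ws (λ b → B b ∧ not (cmp a b)))
                     (#-split ws B (cmp a))
       | ∧-true h
  ... | inj₂ le | Aa , _   = cong₂ _∧_ Aa (≤⇒≤ᵇ-true le)
  ... | inj₁ le | _  , few = ⊥-elim (true≢false (≤⇒≤ᵇ-true le)
                               (trans (sym (not-involutive _)) (cong not few)))

  opaque
    -- Each row is true on half of `B` or false on half of it, so one of the two kinds makes up half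
    -- of `A`. In the second case `half-true` is applied to the negated comparison, which is nested
    -- as well.
    halve : ∀ {cmp} → Nested cmp → ∃[ o ] ConstantHalf cmp o
    halve {cmp} nested
      with half-of-sum (# vs (λ a → A a ∧ manyRow cmp a)) _ (#-split vs A (manyRow cmp))
    ... | inj₁ half = true , half-true nested half
    ... | inj₂ half
      with A′ , B′ , A′⊆ , B′⊆ , hA , hB , const ← half-true (nested-not nested)
             (≤-trans half (*-monoʳ-≤ 2 (#-mono vs (few⇒many cmp)))) =
      false , A′ , B′ , A′⊆ , B′⊆ , hA , hB ,
      λ A′a B′b → trans (sym (not-involutive _)) (cong not (const A′a B′b))

-- Fibres and projections of sets of vectors

module Degree {X : Set} (xs : List X) (all-xs : ∀ x → x ∈ xs) where

  deg : ∀ {n} → Fin (suc n) → (Vec X (suc n) → Bool) → Vec X n → ℕ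
  deg i A v = # xs (λ x → A (insertAt v i x))

  proj : ∀ {n} → Fin (suc n) → (Vec X (suc n) → Bool) → Vec X n → Bool
  proj i A v = 0 <ᵇ deg i A v

  ∣_∣ : ∀ {n} → (Vec X n → Bool) → ℕ
  ∣_∣ {n} = # (vecs xs n)

  Thick : ℕ → ∀ {n} → (Vec X n → Bool) → Set
  Thick τ {zero}  A = ⊤
  Thick τ {suc n} A = ∀ i v → 0 < deg i A v → τ ≤ deg i A v

  proj⇒deg>0 : ∀ {n} i (A : Vec X (suc n) → Bool) {v} → proj i A v ≡ true → 0 < deg i A v
  proj⇒deg>0 i A h = <ᵇ⇒< 0 _ (from T-≡ h)

  proj⁺ : ∀ {n} i (A : Vec X (suc n) → Bool) {v x} → A (insertAt v i x) ≡ true → proj i A v ≡ true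
  proj⁺ i A {x = x} h = to T-≡ (<⇒<ᵇ (#-pos (all-xs x) h))

  proj⁻ : ∀ {n} i (A : Vec X (suc n) → Bool) {v} → proj i A v ≡ true →
          ∃[ x ] A (insertAt v i x) ≡ true
  proj⁻ i A h = #>0 {xs = xs} (proj⇒deg>0 i A h)

  proj-mono : ∀ {n} i {A B : Vec X (suc n) → Bool} → A ⊆ B → proj i A ⊆ proj i B
  proj-mono i {A} {B} A⊆B v h with x , Ax ← proj⁻ i A h = proj⁺ i B (A⊆B _ Ax)

  ∣∣≡∑deg : ∀ {n} i (A : Vec X (suc n) → Bool) → ∣ A ∣ ≡ ∑ (vecs xs n) (deg i A)
  ∣∣≡∑deg i A = ∑-insertAt xs i (λ v → 𝟙 (A v))

  ∣∣-pos-proj : ∀ {n} i {A : Vec X (suc n) → Bool} → 0 < ∣ A ∣ → 0 < ∣ proj i A ∣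
  ∣∣-pos-proj i {A} pos with v , Av ← #>0 {xs = vecs xs _} {A = A} pos
                        with u , x , refl ← insertAt-surjective i v =
    #-pos {A = proj i A} (∈-vecs all-xs u) (proj⁺ i A Av)

  -- A point in a fibre of the projection comes from some value `x` of the forgotten coordinate.
  -- With this `x` kept fixed, the fibre of `A` in the other direction is already large, and it is
  -- contained in the fibre of the projection.
  thick-proj : ∀ {τ n} i {A : Vec X (suc n) → Bool} → Thick τ A → Thick τ (proj i A)
  thick-proj {n = zero}  i thick = tt
  thick-proj {n = suc n} i {A} thick i′ v pos
    with x′ , h ← #>0 {xs = xs} pos
    with x , Ax ← proj⁻ i A h
    with p , p′ , comm ← insertAt-comm i i′ =
    ≤-trans (thick p (insertAt v p′ x)
               (#-pos (all-xs x′) (trans (cong A (sym (comm v x x′))) Ax)))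
            (#-mono xs λ x″ h → proj⁺ i A (trans (cong A (comm v x x″)) h))

  module _ (τ : ℕ) {n : ℕ} where

    prune : Fin (suc n) → (Vec X (suc n) → Bool) → Vec X (suc n) → Bool
    prune i A v = A v ∧ (τ ≤ᵇ deg i A (removeAt v i))

    prune⊆ : ∀ i A → prune i A ⊆ A
    prune⊆ i A v h = proj₁ (∧-true h)

    prune-insertAt : ∀ i A v x →
      prune i A (insertAt v i x) ≡ A (insertAt v i x) ∧ (τ ≤ᵇ deg i A v)
    prune-insertAt i A v x =
      cong (λ u → A (insertAt v i x) ∧ (τ ≤ᵇ deg i A u)) (removeAt-insertAt v i x)

    -- A fibre with at least `τ` points is kept whole. A lighter nonempty one takes fewer than `τ`
    -- points and one projected point with it, so the points lost are at most `τ` times the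
    -- projected points lost.
    prune-fibre : ∀ i A v →
      deg i A v + τ * 𝟙 (proj i (prune i A) v) ≤ deg i (prune i A) v + τ * 𝟙 (proj i A v)
    prune-fibre i A v
      rewrite ∑-cong xs (λ x → cong 𝟙 (prune-insertAt i A v x))
      with τ ≤ᵇ deg i A v in heavy
    ... | true rewrite ∑-cong xs (λ x → cong 𝟙 (∧-identityʳ (A (insertAt v i x)))) = ≤-refl
    ... | false rewrite ∑-cong xs (λ x → cong 𝟙 (∧-zeroʳ (A (insertAt v i x))))
                      | ∑-const xs 0 | *-zeroʳ (length xs) | *-zeroʳ τ
                      | +-identityʳ (deg i A v) with deg i A v
    ...   | zero  = z≤n
    ...   | suc d = ≤-trans (<⇒≤ (≰⇒> λ le → true≢false (≤⇒≤ᵇ-true le) heavy))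
                            (≤-reflexive (sym (*-identityʳ τ)))

    prune-size : ∀ i A → ∣ A ∣ + τ * ∣ proj i (prune i A) ∣ ≤ ∣ prune i A ∣ + τ * ∣ proj i A ∣
    prune-size i A = subst₂ _≤_ (total A (proj i (prune i A))) (total (prune i A) (proj i A))
                            (∑-mono (vecs xs n) (prune-fibre i A))
      where
      total : ∀ C (D : Vec X n → Bool) →
              ∑ (vecs xs n) (λ v → deg i C v + τ * 𝟙 (D v)) ≡ ∣ C ∣ + τ * ∣ D ∣
      total C D = trans (∑-+ (vecs xs n) _ _) (cong₂ _+_ (sym (∣∣≡∑deg i C))
        (trans (∑-cong (vecs xs n) (λ v → *-comm τ _)) (trans (∑-* (vecs xs n) _ τ) (*-comm _ τ))))

    shadow : (Vec X (suc n) → Bool) → ℕ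
    shadow A = ∑ (allFin (suc n)) (λ i → ∣ proj i A ∣)

    -- The potential ∣ A ∣ - τ * shadow A does not decrease, with both sides moved
    -- so that no subtraction occurs.
    prune-potential : ∀ i A → ∣ A ∣ + τ * shadow (prune i A) ≤ ∣ prune i A ∣ + τ * shadow A
    prune-potential i A = combine τ (∣ proj i A ∣) (∣ proj i (prune i A) ∣) (prune-size i A)
      (∑-exchange (λ j → #-mono (vecs xs n) (proj-mono j (prune⊆ i A))) (∈-allFin i))
      where
      combine : ∀ {a a′} t p q {S S′} → a + t * q ≤ a′ + t * p → S′ + p ≤ S + q →
                a + t * S′ ≤ a′ + t * S
      combine {a} {a′} t p q {S} {S′} h₁ h₂ = +-cancelʳ-≤ (t * p) _ _ (begin
        a + t * S′ + t * p  ≡⟨ shift a t S′ p ⟩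
        a + t * (S′ + p)    ≤⟨ +-monoʳ-≤ a (*-monoʳ-≤ t h₂) ⟩
        a + t * (S + q)     ≡⟨ sym (trans (+-swap a (t * q) (t * S)) (shift a t S q)) ⟩
        a + t * q + t * S   ≤⟨ +-monoˡ-≤ (t * S) h₁ ⟩
        a′ + t * p + t * S  ≡⟨ +-swap a′ (t * p) (t * S) ⟩
        a′ + t * S + t * p  ∎)
        where
        open ≤-Reasoning
        shift : ∀ a t x y → a + t * x + t * y ≡ a + t * (x + y)
        shift = solve-∀
        +-swap : ∀ a b c → a + b + c ≡ a + c + b
        +-swap = solve-∀

    -- `N` bounds the recursion, as every effective pruning shrinks `A`. Once no direction shrinks
    -- it, a light nonempty fibre cannot exist, since pruning would remove its points. The size
    -- bound is the potential inequality, added up over the prunings.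
    thicken-within : ∀ N A → ∣ A ∣ < N → Σ[ A′ ∈ (Vec X (suc n) → Bool) ]
      A′ ⊆ A × Thick τ A′ × ∣ A ∣ + τ * shadow A′ ≤ ∣ A′ ∣ + τ * shadow A
    thicken-within (suc N) A A<N with any? (λ i → ∣ prune i A ∣ <? ∣ A ∣)
    ... | no stable = A , (λ v h → h) , thick , ≤-refl
      where
      thick : Thick τ A
      thick i v pos with τ ≤ᵇ deg i A v in heavy
      ... | true  = ≤ᵇ-true⇒≤ heavy
      ... | false with x , Ax ← #>0 {xs = xs} pos =
        contradiction (i , #-strict (prune⊆ i A) (∈-vecs all-xs (insertAt v i x))
          (trans (prune-insertAt i A v x) (trans (cong (A (insertAt v i x) ∧_) heavy) (∧-zeroʳ _))) Ax)
          stable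
    ... | yes (i , smaller)
      with A′ , A′⊆ , thick , size ← thicken-within N (prune i A) (≤-trans smaller (≤-pred A<N)) =
      A′ , (λ v h → prune⊆ i A v (A′⊆ v h)) , thick ,
      chain (∣ A ∣) (τ * shadow A) (∣ prune i A ∣) (τ * shadow (prune i A))
            (∣ A′ ∣) (τ * shadow A′) (prune-potential i A) size
      where
      chain : ∀ a s a₁ s₁ a₂ s₂ → a + s₁ ≤ a₁ + s → a₁ + s₂ ≤ a₂ + s₁ → a + s₂ ≤ a₂ + s
      chain a s a₁ s₁ a₂ s₂ h₁ h₂ = +-cancelʳ-≤ (a₁ + s₁) _ _ (begin
        a + s₂ + (a₁ + s₁)    ≡⟨ pair a s₂ a₁ s₁ ⟩
        a + s₁ + (a₁ + s₂)    ≤⟨ +-mono-≤ h₁ h₂ ⟩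
        a₁ + s + (a₂ + s₁)    ≡⟨ pair′ a₁ s a₂ s₁ ⟩
        a₂ + s + (a₁ + s₁)    ∎)
        where
        open ≤-Reasoning
        pair : ∀ a b c d → a + b + (c + d) ≡ a + d + (c + b)
        pair = solve-∀
        pair′ : ∀ a b c d → a + b + (c + d) ≡ c + b + (a + d)
        pair′ = solve-∀

    opaque
      -- Each of the `suc n` projections has at most `2 * ∣ A ∣ / d` points, so `τ * shadow A` is at
      -- most half of `∣ A ∣`, and this bounds what pruning can lose. The factor 2 in the hypothesis
      -- leaves room for a set that has just been halved.
      thicken : ∀ d A → 4 * (suc n * τ) ≤ d → (∀ i → d * ∣ proj i A ∣ ≤ 2 * ∣ A ∣) →
        Σ[ A′ ∈ (Vec X (suc n) → Bool) ] A′ ⊆ A × Thick τ A′ × ∣ A ∣ ≤ 2 * ∣ A′ ∣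
      thicken d A d-large avg with A′ , A′⊆ , thick , size ← thicken-within _ A ≤-refl =
        A′ , A′⊆ , thick , +-cancelʳ-≤ ∣ A ∣ _ _ (begin
          ∣ A ∣ + ∣ A ∣
            ≡⟨ n+n≡2*n ∣ A ∣ ⟩
          2 * ∣ A ∣
            ≤⟨ *-monoʳ-≤ 2 (≤-trans (m≤m+n (∣ A ∣) (τ * shadow A′)) size) ⟩
          2 * (∣ A′ ∣ + τ * shadow A)
            ≡⟨ *-distribˡ-+ 2 ∣ A′ ∣ _ ⟩
          2 * ∣ A′ ∣ + 2 * (τ * shadow A)
            ≤⟨ +-monoʳ-≤ (2 * ∣ A′ ∣) small ⟩
          2 * ∣ A′ ∣ + ∣ A ∣ ∎)
        where
        open ≤-Reasoning
        term : ∀ i → ∣ proj i A ∣ * (2 * τ * suc n) ≤ ∣ A ∣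
        term i = *-cancelˡ-≤ 2 (begin
          2 * (∣ proj i A ∣ * (2 * τ * suc n)) ≡⟨ regroup ∣ proj i A ∣ τ (suc n) ⟩
          4 * (suc n * τ) * ∣ proj i A ∣       ≤⟨ *-monoˡ-≤ ∣ proj i A ∣ d-large ⟩
          d * ∣ proj i A ∣                     ≤⟨ avg i ⟩
          2 * ∣ A ∣                            ∎)
          where
          regroup : ∀ p t l → 2 * (p * (2 * t * l)) ≡ 4 * (l * t) * p
          regroup = solve-∀
        small : 2 * (τ * shadow A) ≤ ∣ A ∣
        small = *-cancelˡ-≤ (suc n) (begin
          suc n * (2 * (τ * shadow A))
            ≡⟨ regroup (suc n) τ (shadow A) ⟩
          shadow A * (2 * τ * suc n)
            ≡⟨ sym (∑-* (allFin (suc n)) (λ i → ∣ proj i A ∣) (2 * τ * suc n)) ⟩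
          ∑ (allFin (suc n)) (λ i → ∣ proj i A ∣ * (2 * τ * suc n))
            ≤⟨ ∑-≤-length (allFin (suc n)) term ⟩
          length (allFin (suc n)) * ∣ A ∣
            ≡⟨ cong (_* ∣ A ∣) (length-tabulate {n = suc n} (λ j → j)) ⟩
          suc n * ∣ A ∣ ∎)
          where
          regroup : ∀ l t s → l * (2 * (t * s)) ≡ s * (2 * t * l)
          regroup = solve-∀

-- Comparing reals

-- Let `q` separate `x` from `y`, and `p` separate `x′` from `y′`. If `p ≤ q`, then `p` also
-- separates `x` from `y′`; if `q < p`, then `p` would separate `x′` from `y`.
>ᴿ-nested : ∀ {x x′ y y′} → x >ᴿ y → ¬ (x′ >ᴿ y) → x′ >ᴿ y′ → x >ᴿ y′
>ᴿ-nested {x} {x′} {y} {y′} (q , y<q , q<x) x′≯y (p , y′<p , p<x′) with ℚ.<-cmp p q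
... | tri< p<q _ _  = p , y′<p , from (ℝ.lower-rounded x p) (q , p<q , q<x)
... | tri≈ _ refl _ = p , y′<p , q<x
... | tri> _ _ q<p  = contradiction (p , from (ℝ.upper-rounded y p) (q , q<p , y<q) , p<x′) x′≯y

-- Fixing one block of Bob's input

positive-factor : ∀ {c x} p → 0 < c → c ≤ x * p → 0 < x
positive-factor {x = zero}  p c>0 le = contradiction le (<⇒≱ c>0)
positive-factor {x = suc x} p c>0 le = z<s

half-< : ∀ {x y} → 0 < y → 2 * x ≤ y → x < y
half-< {zero}  0<y _  = 0<y
half-< {suc x} _   le = ≤-trans (m<m+n (suc x) z<s) le

bools : List Bool
bools = true ∷ false ∷ []

∈-bools : ∀ b → b ∈ bools
∈-bools true  = here refl
∈-bools false = there (here refl)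

avoids : Bool → ∀ {m} → (Fin m → Bool) → Vec Bool m → Bool
avoids v E []      = true
avoids v E (x ∷ w) = not (E zero ∧ does (x ≟ᵇ v)) ∧ avoids v (λ j → E (suc j)) w

¬avoids : ∀ v {m} (E : Fin m → Bool) w → avoids v E w ≡ false →
          ∃[ j ] E j ≡ true × lookup w j ≡ v
¬avoids v E (x ∷ w) h with E zero in E0 | x ≟ᵇ v
... | true  | yes x≡v = zero , E0 , x≡v
... | true  | no  _   with j , Ej , wj ← ¬avoids v _ w h = suc j , Ej , wj
... | false | _       with j , Ej , wj ← ¬avoids v _ w h = suc j , Ej , wj

-- A position in `E` leaves one choice of bit and any other position two, so `e` positions in `E`
-- leave `2 ^ (m - e)` words; the power is moved to the left to avoid subtraction.
#avoids : ∀ v {m} (E : Fin m → Bool) →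
          # (vecs bools m) (avoids v E) * 2 ^ # (allFin m) E ≤ 2 ^ m
#avoids v {zero}  E = ≤-reflexive (cong₂ (λ a b → a * 2 ^ b) (∑-[x] [] _) (∑-[] _))
#avoids v {suc m} E = begin
  # (vecs bools (suc m)) (avoids v E) * 2 ^ # (allFin (suc m)) E
    ≡⟨ cong₂ (λ a b → a * 2 ^ b)
         (trans (∑-product _∷_ bools (vecs bools m) (λ w → 𝟙 (avoids v E w))) (∑-[x,y] true false _))
         (∑-allFin m (λ j → 𝟙 (E j))) ⟩
  (# (vecs bools m) (λ w → avoids v E (true ∷ w)) + # (vecs bools m) (λ w → avoids v E (false ∷ w)))
    * 2 ^ (𝟙 (E zero) + e)
    ≡⟨ count v (E zero) ⟩
  2 * (# (vecs bools m) (avoids v E⁺) * 2 ^ e)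
    ≤⟨ *-monoʳ-≤ 2 (#avoids v E⁺) ⟩
  2 ^ suc m ∎
  where
  open ≤-Reasoning
  E⁺ : Fin m → Bool
  E⁺ j = E (suc j)
  e : ℕ
  e = # (allFin m) E⁺
  none : ∑ (vecs bools m) (λ _ → 0) ≡ 0
  none = trans (∑-const (vecs bools m) 0) (*-zeroʳ (length (vecs bools m)))
  branch : Bool → Bool → Bool → ℕ
  branch v E0 x = # (vecs bools m) (λ w → not (E0 ∧ does (x ≟ᵇ v)) ∧ avoids v E⁺ w)
  both : ∀ n p → (n + n) * p ≡ 2 * (n * p)
  both = solve-∀
  left : ∀ n p → (n + 0) * (2 * p) ≡ 2 * (n * p)
  left = solve-∀
  right : ∀ n p → (0 + n) * (2 * p) ≡ 2 * (n * p)
  right = solve-∀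
  count : ∀ v E0 → (branch v E0 true + branch v E0 false) * 2 ^ (𝟙 E0 + e) ≡
                   2 * (# (vecs bools m) (avoids v E⁺) * 2 ^ e)
  count v     false = both (# (vecs bools m) (avoids v E⁺)) (2 ^ e)
  count true  true  rewrite none = right (# (vecs bools m) (avoids true E⁺)) (2 ^ e)
  count false true  rewrite none = left (# (vecs bools m) (avoids false E⁺)) (2 ^ e)

hits : ∀ {m ℓ} → Vec (Fin m) ℓ → Vec (Vec Bool m) ℓ → Bool
hits []      []      = false
hits (j ∷ a) (w ∷ b) = lookup w j ∨ hits a b

hits-insertAt : ∀ {m ℓ} (i : Fin (suc ℓ)) (a : Vec (Fin m) ℓ) b j w →
                hits (insertAt a i j) (insertAt b i w) ≡ lookup w j ∨ hits a b
hits-insertAt zero    a       b        j w = refl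
hits-insertAt {ℓ = suc ℓ} (suc i) (j′ ∷ a) (w′ ∷ b) j w
  rewrite hits-insertAt i a b j w with lookup w′ j′ | lookup w j
... | true  | true  = refl
... | true  | false = refl
... | false | _     = refl

module Blocks (m : ℕ) .{{_ : NonZero m}} (τ : ℕ) where

  pointers : List (Fin m)
  pointers = allFin m

  words : List (Vec Bool m)
  words = vecs bools m

  open Degree pointers ∈-allFin public

  ∥_∥ : ∀ {ℓ} → (Vec (Vec Bool m) ℓ → Bool) → ℕ
  ∥_∥ {ℓ} = # (vecs words ℓ)

  length-pointers : length pointers ≡ m
  length-pointers = length-tabulate (λ j → j)

  length-words : length words ≡ 2 ^ m
  length-words = length-vecs bools m

  instance
    2^m≢0 : NonZero (2 ^ m)
    2^m≢0 = m^n≢0 2 m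

  ∣∣≤ : ∀ {ℓ} (A : Vec (Fin m) ℓ → Bool) → ∣ A ∣ ≤ m ^ ℓ
  ∣∣≤ {ℓ} A = ≤-trans (#≤length (vecs pointers ℓ) A)
    (≤-reflexive (trans (length-vecs pointers ℓ) (cong (_^ ℓ) length-pointers)))

  ∥∥≤ : ∀ {ℓ} (B : Vec (Vec Bool m) ℓ → Bool) → ∥ B ∥ ≤ (2 ^ m) ^ ℓ
  ∥∥≤ {ℓ} B = ≤-trans (#≤length (vecs words ℓ) B)
    (≤-reflexive (trans (length-vecs words ℓ) (cong (_^ ℓ) length-words)))

  module _ (v : Bool) {ℓ : ℕ} (i : Fin (suc ℓ)) (A : Vec (Fin m) (suc ℓ) → Bool)
           (B : Vec (Vec Bool m) (suc ℓ) → Bool) where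

    -- The bad event of the union bound, for pointers `u` of the other blocks and a candidate word
    -- `w` for block `i`. The bit `v` is `false` when the block is to be made disjoint and `true`
    -- when it is to be hit.
    miss : Vec (Fin m) ℓ → Vec Bool m → Bool
    miss u w = proj i A u ∧ avoids v (λ j → A (insertAt u i j)) w

    misses : Vec Bool m → ℕ
    misses w = ∣ (λ u → miss u w) ∣

    slice : Vec Bool m → ℕ
    slice w = ∥ (λ b → B (insertAt b i w)) ∥

    module _ (β : ℕ) (thick : Thick τ A) (τ-large : m ^ ℓ * 2 ^ (2 + β) ≤ 2 ^ τ)
             (B-large : (2 ^ m) ^ suc ℓ ≤ ∥ B ∥ * 2 ^ β) where

      open ≤-Reasoning

      private
        -- `V` counts all choices of words for the other blocks. As `B` has density at least
        -- `1 / 2 ^ β`, the aim is a slice of density at least `1 / e`, half of that.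
        V e : ℕ
        V = (2 ^ m) ^ ℓ
        e = 2 ^ (1 + β)

      #miss : ∀ u → # words (miss u) * 2 ^ τ ≤ 2 ^ m
      #miss u with true-or-false (proj i A u)
      ... | inj₁ h = begin
        # words (miss u) * 2 ^ τ
          ≤⟨ *-mono-≤ (#-mono words (λ w b → proj₂ (∧-true b)))
                      (^-monoʳ-≤ 2 (thick i u (proj⇒deg>0 i A h))) ⟩
        # words (avoids v (λ j → A (insertAt u i j))) * 2 ^ deg i A u
          ≤⟨ #avoids v (λ j → A (insertAt u i j)) ⟩
        2 ^ m ∎
      ... | inj₂ h = begin
        # words (miss u) * 2 ^ τ
          ≡⟨ cong (_* 2 ^ τ) (∑-cong words (λ w →
               cong (λ p → 𝟙 (p ∧ avoids v (λ j → A (insertAt u i j)) w)) h)) ⟩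
        ∑ words (λ _ → 0) * 2 ^ τ
          ≡⟨ cong (_* 2 ^ τ) (trans (∑-const words 0) (*-zeroʳ (length words))) ⟩
        0 ≤⟨ z≤n ⟩
        2 ^ m ∎

      ∑misses : ∑ words misses * 2 ^ τ ≤ m ^ ℓ * 2 ^ m
      ∑misses = begin
        ∑ words misses * 2 ^ τ
          ≡⟨ cong (_* 2 ^ τ) (∑-swap words (vecs pointers ℓ) (λ w u → 𝟙 (miss u w))) ⟩
        ∑ (vecs pointers ℓ) (λ u → # words (miss u)) * 2 ^ τ
          ≡⟨ sym (∑-* (vecs pointers ℓ) (λ u → # words (miss u)) (2 ^ τ)) ⟩
        ∑ (vecs pointers ℓ) (λ u → # words (miss u) * 2 ^ τ)
          ≤⟨ ∑-≤-length (vecs pointers ℓ) #miss ⟩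
        length (vecs pointers ℓ) * 2 ^ m
          ≡⟨ cong (_* 2 ^ m) (trans (length-vecs pointers ℓ) (cong (_^ ℓ) length-pointers)) ⟩
        m ^ ℓ * 2 ^ m ∎

      -- `τ-large` outweighs the `m ^ ℓ` pointer vectors of the union bound: on average a word has
      -- at most `1 / (2 * e)` misses.
      ∑misses-small : 2 * (∑ words misses * e) ≤ 2 ^ m
      ∑misses-small = *-cancelˡ-≤ (m ^ ℓ) {{m^n≢0 m ℓ}} (begin
        m ^ ℓ * (2 * (∑ words misses * e))  ≡⟨ regroup (m ^ ℓ) (∑ words misses) e ⟩
        ∑ words misses * (m ^ ℓ * (2 * e))  ≤⟨ *-monoʳ-≤ (∑ words misses) τ-large ⟩
        ∑ words misses * 2 ^ τ              ≤⟨ ∑misses ⟩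
        m ^ ℓ * 2 ^ m                       ∎)
        where
        regroup : ∀ u n e → u * (2 * (n * e)) ≡ n * (u * (2 * e))
        regroup = solve-∀

      V>0 : 0 < V
      V>0 = m^n>0 (2 ^ m) ℓ

      opaque
        -- One inequality for both demands on a word. By `B-large` the right side is at least
        -- `2 * (2 ^ m * V)`; on the left the first term sums to half of this and the second, by
        -- `∑misses-small`, to less than the other half.
        gap : ∑ words (λ w → V + misses w * (V * e)) < ∑ words (λ w → slice w * e)
        gap = begin-strict
          ∑ words (λ w → V + misses w * (V * e))
            ≡⟨ ∑-+ words (λ _ → V) (λ w → misses w * (V * e)) ⟩
          ∑ words (λ _ → V) + ∑ words (λ w → misses w * (V * e))
            ≡⟨ cong₂ _+_ (trans (∑-const words V) (cong (_* V) length-words)) (∑-* words misses (V * e)) ⟩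
          2 ^ m * V + ∑ words misses * (V * e)
            <⟨ +-monoʳ-< (2 ^ m * V) (half-< (*-mono-≤ (m^n>0 2 m) V>0) (begin
                 2 * (∑ words misses * (V * e)) ≡⟨ regroup (∑ words misses) V e ⟩
                 2 * (∑ words misses * e) * V   ≤⟨ *-monoˡ-≤ V ∑misses-small ⟩
                 2 ^ m * V ∎)) ⟩
          2 ^ m * V + 2 ^ m * V
            ≡⟨ n+n≡2*n (2 ^ m * V) ⟩
          2 * (2 ^ m * V)
            ≤⟨ *-monoʳ-≤ 2 B-large ⟩
          2 * (∥ B ∥ * 2 ^ β)
            ≡⟨ assoc ∥ B ∥ (2 ^ β) ⟩
          ∥ B ∥ * e
            ≡⟨ cong (_* e) (trans (∑-insertAt words i (λ b → 𝟙 (B b)))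
                 (∑-swap (vecs words ℓ) words (λ b w → 𝟙 (B (insertAt b i w))))) ⟩
          ∑ words slice * e
            ≡⟨ sym (∑-* words slice e) ⟩
          ∑ words (λ w → slice w * e) ∎
          where
          regroup : ∀ n v e → 2 * (n * (v * e)) ≡ 2 * (n * e) * v
          regroup = solve-∀
          assoc : ∀ a b → 2 * (a * b) ≡ a * (2 * b)
          assoc = solve-∀

      opaque
        -- A word that satisfies the inequality of `gap` pointwise has a large slice. It has no miss
        -- either, since one miss alone contributes `V * e`, which `slice w * e` cannot exceed.
        restrict : ∃[ w ]
          (∀ u → proj i A u ≡ true → ∃[ j ] A (insertAt u i j) ≡ true × lookup w j ≡ v) ×
          V ≤ slice w * e
        restrict
          with w , _ , w-good ← ∑-pigeonhole (λ w → slice w * e)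
                 (λ w → V + misses w * (V * e)) words gap =
          w , hit , ≤-trans (m≤m+n V _) (<⇒≤ w-good)
          where
          hit : ∀ u → proj i A u ≡ true → ∃[ j ] A (insertAt u i j) ≡ true × lookup w j ≡ v
          hit u h with true-or-false (avoids v (λ j → A (insertAt u i j)) w)
          ... | inj₂ ¬av = ¬avoids v (λ j → A (insertAt u i j)) w ¬av
          ... | inj₁ av  = contradiction (begin
              slice w * e              ≤⟨ *-monoˡ-≤ e (∥∥≤ (λ b → B (insertAt b i w))) ⟩
              V * e                    ≡⟨ sym (*-identityˡ (V * e)) ⟩
              1 * (V * e)              ≤⟨ *-monoˡ-≤ (V * e) (#-pos (∈-vecs ∈-allFin u) (cong₂ _∧_ h av)) ⟩
              misses w * (V * e)       ≤⟨ m≤n+m _ V ⟩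
              V + misses w * (V * e)   ∎)
            (<⇒≱ w-good)

  -- Blocks are fixed one at a time by a word that offers every remaining pointer vector a `false`
  -- bit. Each costs `B` a factor 2, whence the `ℓ` in the exponent, and projecting keeps `A` thick.
  some-disjoint : ∀ {ℓ} (A : Vec (Fin m) ℓ → Bool) (B : Vec (Vec Bool m) ℓ → Bool) β →
    Thick τ A → m ^ ℓ * 2 ^ (1 + (β + ℓ)) ≤ 2 ^ τ → 0 < ∣ A ∣ → (2 ^ m) ^ ℓ ≤ ∥ B ∥ * 2 ^ β →
    ∃[ a ] ∃[ b ] A a ≡ true × B b ≡ true × hits a b ≡ false
  some-disjoint {zero} A B β thick τ-large A-pos B-large
    with [] , Aa ← #>0 {xs = vecs pointers 0} {A = A} A-pos
    with [] , Bb ← #>0 {xs = vecs words 0} {A = B} (positive-factor (2 ^ β) z<s B-large) =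
    [] , [] , Aa , Bb , refl
  some-disjoint {suc ℓ} A B β thick τ-large A-pos B-large
    with w , hit , large ← restrict false zero A B β thick
           (≤-trans (*-mono-≤ (^-monoʳ-≤ m (n≤1+n ℓ))
                              (^-monoʳ-≤ 2 (s≤s (≤-trans (≤-reflexive (+-comm 1 β))
                                                         (+-monoʳ-≤ β (s≤s z≤n))))))
                    τ-large)
           B-large
    with a , b , PAa , Bb , disj ← some-disjoint (proj zero A) (λ b → B (w ∷ b)) (1 + β)
           (thick-proj zero {A} thick)
           (≤-trans (*-mono-≤ (^-monoʳ-≤ m (n≤1+n ℓ))
                              (^-monoʳ-≤ 2 (s≤s (≤-reflexive (sym (+-suc β ℓ)))))) τ-large)
           (∣∣-pos-proj zero {A} A-pos) large
    with j , Aa , wj ← hit a PAa =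
    j ∷ a , w ∷ b , Aa , Bb , trans (cong (_∨ hits a b) wj) disj

  -- A single block with a `true` bit is enough, so the other blocks may take any values that
  -- survive.
  some-intersecting : ∀ {ℓ} (A : Vec (Fin m) (suc ℓ) → Bool) (B : Vec (Vec Bool m) (suc ℓ) → Bool) β →
    Thick τ A → m ^ ℓ * 2 ^ (2 + β) ≤ 2 ^ τ → 0 < ∣ A ∣ → (2 ^ m) ^ suc ℓ ≤ ∥ B ∥ * 2 ^ β →
    ∃[ a ] ∃[ b ] A a ≡ true × B b ≡ true × hits a b ≡ true
  some-intersecting {ℓ} A B β thick τ-large A-pos B-large
    with w , hit , large ← restrict true zero A B β thick τ-large B-large
    with a , PAa ← #>0 {xs = vecs pointers ℓ} {A = proj zero A} (∣∣-pos-proj zero {A} A-pos)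
    with j , Aa , wj ← hit a PAa
    with b , Bb ← #>0 {xs = vecs words ℓ} {A = λ b → B (w ∷ b)}
                    (positive-factor (2 ^ (1 + β)) (m^n>0 (2 ^ m) ℓ) large) =
    j ∷ a , w ∷ b , Aa , Bb , cong (_∨ hits a b) wj

-- The adversary

module _ {X Y : Set} where

  -- The order of the reals is not decidable constructively, so the referee's bit is read off from a
  -- derivation of `Outputs` and kept with what it certifies.
  Answer : (X → ℝ) → (Y → ℝ) → (P₁ P₀ : Protocol X Y) → X → Y → Bool → Bool → Set₁
  Answer rA rB P₁ P₀ x y o true  = (rA x >ᴿ rB y) × Outputs P₁ x y o
  Answer rA rB P₁ P₀ x y o false = ¬ (rA x >ᴿ rB y) × Outputs P₀ x y o

  answer : ∀ {rA rB P₁ P₀ x y o} → Outputs (ask rA rB P₁ P₀) x y o →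
           Σ[ c ∈ Bool ] Answer rA rB P₁ P₀ x y o c
  answer (on-1 gt out)  = true , gt , out
  answer (on-0 ngt out) = false , ngt , out

  continue : ∀ {rA rB P₁ P₀ x y o} c → Answer rA rB P₁ P₀ x y o c →
             Outputs (if c then P₁ else P₀) x y o
  continue true  (_ , out) = out
  continue false (_ , out) = out

  rounds-child : ∀ {rA rB} {P₁ P₀ : Protocol X Y} c →
                 rounds (if c then P₁ else P₀) < rounds (ask rA rB P₁ P₀)
  rounds-child true  = s≤s (m≤m⊔n _ _)
  rounds-child false = s≤s (m≤n⊔m _ _)

  leaf-output : ∀ {c x y o} → Outputs {X} {Y} (leaf c) x y o → o ≡ c
  leaf-output at-leaf = refl

-- `d-large` keeps half of `A` during thickening, `m-large` gives the factor 4 in density when a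
-- block is fixed, and `τ-large` serves the union bounds, in which up to `k` rounds and `k` fixed
-- blocks have thinned out `B`.
module Adversary (m : ℕ) .{{_ : NonZero m}} (k τ d : ℕ) (d-large : 4 * (k * τ) ≤ d)
  (m-large : 4 * d ≤ m) (τ-large : m ^ k * 2 ^ (2 + (k + k)) ≤ 2 ^ τ) {X Y : Set} where

  open Blocks m τ

  Dense : ∀ {ℓ} → (Vec (Fin m) ℓ → Bool) → Set
  Dense {zero}  A = ⊤
  Dense {suc ℓ} A = ∀ i → d * ∣ proj i A ∣ ≤ ∣ A ∣

  -- s rounds are over, f blocks have been fixed and ℓ are live.  A round costs A
  -- a factor 4 and B a factor 2; fixing a block makes A denser by a factor 4 and
  -- B sparser by a factor 2.
  record State (P : Protocol X Y) (s ℓ f : ℕ) : Set₁ where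
    field
      A       : Vec (Fin m) ℓ → Bool
      B       : Vec (Vec Bool m) ℓ → Bool
      toAlice : Vec (Fin m) ℓ → X
      toBob   : Vec (Vec Bool m) ℓ → Y
      live    : ℓ + f ≡ k
      A-large : m ^ ℓ * 4 ^ f ≤ ∣ A ∣ * 4 ^ s
      B-large : (2 ^ m) ^ ℓ ≤ ∥ B ∥ * 2 ^ (s + f)
      correct : ∀ {a b} → A a ≡ true → B b ≡ true → Outputs P (toAlice a) (toBob b) (hits a b)

  open State

  ℓ≤k : ∀ {P s ℓ f} → State P s ℓ f → ℓ ≤ k
  ℓ≤k {f = f} S = subst (_ ≤_) (live S) (m≤m+n _ f)

  -- `A` has at most `m ^ ℓ` points, so in `A-large` the gain `4 ^ f` cannot exceed the loss
  -- `4 ^ s`.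
  fixed≤rounds : ∀ {P s ℓ f} → State P s ℓ f → f ≤ s
  fixed≤rounds {s = s} {ℓ} {f} S = ≮⇒≥ λ s<f → <⇒≱ (^-monoʳ-< 4 (s≤s (s≤s z≤n)) s<f)
    (*-cancelˡ-≤ (m ^ ℓ) {{m^n≢0 m ℓ}} (≤-trans (A-large S) (*-monoˡ-≤ (4 ^ s) (∣∣≤ (A S)))))

  A-pos : ∀ {P s ℓ f} (S : State P s ℓ f) → 0 < ∣ A S ∣
  A-pos {s = s} {ℓ} {f} S = positive-factor (4 ^ s) (*-mono-≤ (m^n>0 m ℓ) (m^n>0 4 f)) (A-large S)

  τ-enough : ∀ {ℓ β} → ℓ ≤ k → β ≤ 2 + (k + k) → m ^ ℓ * 2 ^ β ≤ 2 ^ τ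
  τ-enough ℓ≤k β≤ = ≤-trans (*-mono-≤ (^-monoʳ-≤ m ℓ≤k) (^-monoʳ-≤ 2 β≤)) τ-large

  module _ {rA rB P₁ P₀ s ℓ f} (S : State (ask rA rB P₁ P₀) s (suc ℓ) f) where

    Ans : ∀ a b → Bool → Set₁
    Ans a b = Answer rA rB P₁ P₀ (toAlice S a) (toBob S b) (hits a b)

    compared : ∀ a b → Σ[ c ∈ Bool ] (A S a ≡ true → B S b ≡ true → Ans a b c)
    compared a b with true-or-false (A S a) | true-or-false (B S b)
    -- Outside the rectangle the state promises nothing, so the bit there is a dummy.
    ... | inj₂ ¬Aa | _        = true , λ Aa → ⊥-elim (true≢false Aa ¬Aa)
    ... | inj₁ _   | inj₂ ¬Bb = true , λ _ Bb → ⊥-elim (true≢false Bb ¬Bb)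
    ... | inj₁ Aa  | inj₁ Bb  with c , ans ← answer (correct S Aa Bb) = c , λ _ _ → ans

    cmp : Vec (Fin m) (suc ℓ) → Vec (Vec Bool m) (suc ℓ) → Bool
    cmp a b = proj₁ (compared a b)

    open Halving (∈-vecs ∈-allFin) (∈-vecs (∈-vecs ∈-bools)) (A S) (B S)

    wins : ∀ {a b} → A S a ≡ true → B S b ≡ true → cmp a b ≡ true →
           rA (toAlice S a) >ᴿ rB (toBob S b)
    wins {a} {b} Aa Bb h = proj₁ (subst (Ans a b) h (proj₂ (compared a b) Aa Bb))

    loses : ∀ {a b} → A S a ≡ true → B S b ≡ true → cmp a b ≡ false →
            ¬ (rA (toAlice S a) >ᴿ rB (toBob S b))
    loses {a} {b} Aa Bb h = proj₁ (subst (Ans a b) h (proj₂ (compared a b) Aa Bb))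

    nested : Nested cmp
    nested {a} {a′} {b} {b′} Aa Aa′ Bb Bb′ p q r with true-or-false (cmp a b′)
    ... | inj₁ h = h
    ... | inj₂ h = contradiction
      (>ᴿ-nested {rA (toAlice S a)} {rA (toAlice S a′)} {rB (toBob S b)} {rB (toBob S b′)}
                 (wins Aa Bb p) (loses Aa′ Bb q) (wins Aa′ Bb′ r))
      (loses Aa Bb′ h)

    opaque
      round : Dense (A S) →
        ∃[ c ] Σ[ S′ ∈ State (if c then P₁ else P₀) (suc s) (suc ℓ) f ] Thick τ (A S′)
      round dense
        with c , A₁ , B₁ , A₁⊆ , B₁⊆ , A₁-half , B₁-half , const ← halve {cmp} nested
        with A₂ , A₂⊆ , thick , A₂-half ← thicken τ d A₁
               (≤-trans (*-monoʳ-≤ 4 (*-monoˡ-≤ τ (ℓ≤k S))) d-large)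
               -- `A₁` keeps half of `A` and its projections have not grown, so density passes on
               -- with the factor 2 that `thicken` allows.
               (λ i → ≤-trans (*-monoʳ-≤ d (#-mono (vecs pointers ℓ) (proj-mono i A₁⊆)))
                              (≤-trans (dense i) A₁-half))
        = c , record
          { A       = A₂
          ; B       = B₁
          ; toAlice = toAlice S
          ; toBob   = toBob S
          ; live    = live S
          ; A-large = ≤-trans (A-large S) (≤-trans
              (*-monoˡ-≤ (4 ^ s) (≤-trans A₁-half (*-monoʳ-≤ 2 A₂-half)))
              (≤-reflexive (quadruple ∣ A₂ ∣ (4 ^ s))))
          ; B-large = ≤-trans (B-large S) (≤-trans (*-monoˡ-≤ (2 ^ (s + f)) B₁-half)
              (≤-reflexive (double ∥ B₁ ∥ (2 ^ (s + f)))))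
          ; correct = λ {a} {b} Aa Bb → continue c (subst (Ans a b) (const (A₂⊆ a Aa) Bb)
              (proj₂ (compared a b) (A₁⊆ a (A₂⊆ a Aa)) (B₁⊆ b Bb)))
          } , thick
        where
        quadruple : ∀ a p → 2 * (2 * a) * p ≡ a * (4 * p)
        quadruple = solve-∀
        double : ∀ a p → 2 * a * p ≡ a * (2 * p)
        double = solve-∀

  opaque
    fixBlock : ∀ {P s ℓ f} (S : State P s (suc ℓ) f) → s ≤ k → Thick τ (A S) →
      ∀ i → ∣ A S ∣ < d * ∣ proj i (A S) ∣ →
      Σ[ S′ ∈ State P s ℓ (suc f) ] Thick τ (A S′)
    fixBlock {s = s} {ℓ} {f} S s≤k thick i thin
      with w , hit , large ← restrict false i (A S) (B S) (s + f) thick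
             (τ-enough (≤-trans (n≤1+n ℓ) (ℓ≤k S))
               (+-monoʳ-≤ 2 (+-mono-≤ s≤k (≤-trans (fixed≤rounds S) s≤k))))
             (B-large S)
      = record
        { A       = proj i (A S)
        ; B       = λ b → B S (insertAt b i w)
        ; toAlice = λ u → toAlice S (insertAt u i (pick u))
        ; toBob   = λ b → toBob S (insertAt b i w)
        ; live    = trans (+-suc ℓ f) (live S)
        -- Forgetting block `i` divides the ambient space by `m` but `A` by less than `d`, and
        -- `4 * d ≤ m`.
        ; A-large = *-cancelˡ-≤ m (begin
            m * (m ^ ℓ * (4 * 4 ^ f))     ≡⟨ regroup m (m ^ ℓ) (4 ^ f) ⟩
            4 * (m * m ^ ℓ * 4 ^ f)       ≤⟨ *-monoʳ-≤ 4 (A-large S) ⟩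
            4 * (∣ A S ∣ * 4 ^ s)          ≤⟨ *-monoʳ-≤ 4 (*-monoˡ-≤ (4 ^ s) (<⇒≤ thin)) ⟩
            4 * (d * ∣ proj i (A S) ∣ * 4 ^ s) ≡⟨ regroup′ d ∣ proj i (A S) ∣ (4 ^ s) ⟩
            4 * d * (∣ proj i (A S) ∣ * 4 ^ s) ≤⟨ *-monoˡ-≤ _ m-large ⟩
            m * (∣ proj i (A S) ∣ * 4 ^ s) ∎)
        ; B-large = subst (λ e → (2 ^ m) ^ ℓ ≤ ∥ (λ b → B S (insertAt b i w)) ∥ * 2 ^ e)
                          (sym (+-suc s f)) large
        ; correct = λ {u} {b} PAu Bb → subst (Outputs _ _ _)
            (trans (hits-insertAt i u b (pick u) w) (cong (_∨ hits u b) (proj₂ (pick-good PAu))))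
            (correct S (proj₁ (pick-good PAu)) Bb)
        } , thick-proj i {A S} thick
      where
      open ≤-Reasoning
      regroup : ∀ m u p → m * (u * (4 * p)) ≡ 4 * (m * u * p)
      regroup = solve-∀
      regroup′ : ∀ d a p → 4 * (d * a * p) ≡ 4 * d * (a * p)
      regroup′ = solve-∀
      pick : Vec (Fin m) ℓ → Fin m
      pick u with true-or-false (proj i (A S) u)
      ... | inj₁ h = proj₁ (hit u h)
      -- Off the projection the pointer is arbitrary, because `correct` claims nothing there.
      ... | inj₂ _ = fromℕ< (>-nonZero⁻¹ m)
      pick-good : ∀ {u} → proj i (A S) u ≡ true →
                  A S (insertAt u i (pick u)) ≡ true × lookup w (pick u) ≡ false
      pick-good {u} PAu with true-or-false (proj i (A S) u)
      ... | inj₁ h = proj₂ (hit u h)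
      ... | inj₂ h = ⊥-elim (true≢false PAu h)

  opaque
    -- Every fixed block lowers `ℓ`, and thickness survives in the projection, so blocks are fixed
    -- until none is thin or none is live. No round is spent.
    settle : ∀ {P s} ℓ {f} (S : State P s ℓ f) → s ≤ k → Thick τ (A S) →
             ∃[ ℓ′ ] ∃[ f′ ] Σ[ S′ ∈ State P s ℓ′ f′ ] Dense (A S′)
    settle zero    S s≤k thick = _ , _ , S , tt
    settle (suc ℓ) S s≤k thick with any? (λ i → ∣ A S ∣ <? d * ∣ proj i (A S) ∣)
    ... | no  all-dense = _ , _ , S , λ i → ≮⇒≥ λ thin → all-dense (i , thin)
    ... | yes (i , thin) with S′ , thick′ ← fixBlock S s≤k thick i thin = settle ℓ S′ s≤k thick′

  -- Induction on the protocol. Without live blocks all `k` are fixed, and `fixed≤rounds` charges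
  -- each to a round. Otherwise, as long as `s < k`, the union bounds are available, and an `ask`
  -- costs one round and leads to a dense state again.
  many-rounds : ∀ P {s ℓ f} (S : State P s ℓ f) → Dense (A S) → k ≤ s + rounds P
  many-rounds P {s} {zero} S dense = subst (_≤ s + rounds P) (live S)
    (≤-trans (fixed≤rounds S) (m≤m+n s _))
  many-rounds P {s} {suc ℓ} S dense with s <? k
  ... | no s≮k = ≤-trans (≮⇒≥ s≮k) (m≤m+n s _)
  -- A dense rectangle need not be thick, so it is thickened once more. It then contains a disjoint
  -- and an intersecting pair, which cannot share the label `c`.
  many-rounds (leaf c) {s} {suc ℓ} {f} S dense | yes s<k
    with A′ , A′⊆ , thick , half ← thicken τ d (A S)
           (≤-trans (*-monoʳ-≤ 4 (*-monoˡ-≤ τ (ℓ≤k S))) d-large)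
           (λ i → ≤-trans (dense i) (m≤n*m _ 2))
    with A′-pos ← positive-factor {x = ∣ A′ ∣} 2 (A-pos S)
           (≤-trans half (≤-reflexive (*-comm 2 ∣ A′ ∣)))
    with a₀ , b₀ , Aa₀ , Bb₀ , disj ← some-disjoint A′ (B S) (s + f) thick
           (τ-enough (ℓ≤k S) (+-mono-≤ {1} {2} (s≤s z≤n) (≤-trans
             (≤-reflexive (trans (+-assoc s f (suc ℓ))
                                 (cong (s +_) (trans (+-comm f (suc ℓ)) (live S)))))
             (+-monoˡ-≤ k (<⇒≤ s<k)))))
           A′-pos (B-large S)
    with a₁ , b₁ , Aa₁ , Bb₁ , inter ← some-intersecting A′ (B S) (s + f) thick
           (τ-enough (≤-trans (n≤1+n ℓ) (ℓ≤k S))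
             (+-monoʳ-≤ 2 (+-mono-≤ (<⇒≤ s<k) (≤-trans (fixed≤rounds S) (<⇒≤ s<k)))))
           A′-pos (B-large S)
    = ⊥-elim (true≢false (trans (sym (leaf-output (correct S (A′⊆ a₁ Aa₁) Bb₁))) inter)
                         (trans (sym (leaf-output (correct S (A′⊆ a₀ Aa₀) Bb₀))) disj))
  many-rounds (ask rA rB P₁ P₀) {s} {suc ℓ} S dense | yes s<k
    with c , S₁ , thick ← round S dense
    with ℓ′ , f′ , S₂ , dense′ ← settle (suc ℓ) S₁ s<k thick
    = ≤-trans (IH c S₂ dense′) (≤-trans (≤-reflexive (sym (+-suc s _)))
        (+-monoʳ-≤ s (rounds-child {rA = rA} {rB} {P₁} {P₀} c)))
    where
    IH : ∀ c {ℓ f} (S : State (if c then P₁ else P₀) (suc s) ℓ f) → Dense (A S) →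
         k ≤ suc s + rounds (if c then P₁ else P₀)
    IH true  = many-rounds P₁
    IH false = many-rounds P₀

  ∣full∣ : ∀ ℓ → ∣ (λ (_ : Vec (Fin m) ℓ) → true) ∣ ≡ m ^ ℓ
  ∣full∣ ℓ = trans (∑-const (vecs pointers ℓ) 1) (trans (*-identityʳ _)
    (trans (length-vecs pointers ℓ) (cong (_^ ℓ) length-pointers)))

  ∥full∥ : ∀ ℓ → ∥ (λ (_ : Vec (Vec Bool m) ℓ) → true) ∥ ≡ (2 ^ m) ^ ℓ
  ∥full∥ ℓ = trans (∑-const (vecs words ℓ) 1) (trans (*-identityʳ _)
    (trans (length-vecs words ℓ) (cong (_^ ℓ) length-words)))

  dense-full : ∀ ℓ → Dense (λ (_ : Vec (Fin m) ℓ) → true)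
  dense-full zero    = tt
  dense-full (suc ℓ) i = ≤-trans
    (*-mono-≤ (≤-trans (m≤n*m d 4) m-large) (∣∣≤ (proj i (λ _ → true))))
    (≤-reflexive (sym (∣full∣ (suc ℓ))))

  lower-bound : (P : Protocol X Y) (toAlice : Vec (Fin m) k → X) (toBob : Vec (Vec Bool m) k → Y) →
                (∀ a b → Outputs P (toAlice a) (toBob b) (hits a b)) → k ≤ rounds P
  lower-bound P toAlice toBob correct = many-rounds P start (dense-full k)
    where
    start : State P 0 k 0
    start = record
      { A       = λ _ → true
      ; B       = λ _ → true
      ; toAlice = toAlice
      ; toBob   = toBob
      ; live    = +-identityʳ k
      ; A-large = *-monoˡ-≤ 1 (≤-reflexive (sym (∣full∣ k)))
      ; B-large = ≤-reflexive (trans (sym (∥full∥ k)) (sym (*-identityʳ _)))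
      ; correct = λ {a} {b} _ _ → correct a b
      }

-- Set disjointness on pointers and words

sides : ∀ n → Partition (Var n)
sides n (inj₁ _) = alice
sides n (inj₂ _) = bob

aliceInput : ∀ {n} → (Fin n → Bool) → Input (sides n) alice
aliceInput x (inj₁ i) _ = x i

bobInput : ∀ {n} → (Fin n → Bool) → Input (sides n) bob
bobInput y (inj₂ i) _ = y i

OR⁺ : ∀ {n} (z : Fin n → Bool) i → z i ≡ true → OR z ≡ true
OR⁺ z zero    h rewrite h = refl
OR⁺ z (suc i) h rewrite OR⁺ (λ i → z (suc i)) i h = ∨-zeroʳ (z zero)

OR⁻ : ∀ {n} (z : Fin n → Bool) → OR z ≡ true → ∃[ i ] z i ≡ true
OR⁻ {suc n} z h with true-or-false (z zero)
... | inj₁ z0 = zero , z0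
... | inj₂ z0 with i , zi ← OR⁻ (λ i → z (suc i)) (trans (cong (_∨ OR (λ i → z (suc i))) (sym z0)) h) =
  suc i , zi

hits⁺ : ∀ {m ℓ} (a : Vec (Fin m) ℓ) b i → lookup (lookup b i) (lookup a i) ≡ true → hits a b ≡ true
hits⁺ (j ∷ a) (w ∷ b) zero    h rewrite h = refl
hits⁺ (j ∷ a) (w ∷ b) (suc i) h rewrite hits⁺ a b i h = ∨-zeroʳ (lookup w j)

hits⁻ : ∀ {m ℓ} (a : Vec (Fin m) ℓ) b → hits a b ≡ true → ∃[ i ] lookup (lookup b i) (lookup a i) ≡ true
hits⁻ [] [] ()
hits⁻ (j ∷ a) (w ∷ b) h with true-or-false (lookup w j)
... | inj₁ wj = zero , wj
... | inj₂ wj with i , hi ← hits⁻ a b (trans (cong (_∨ hits a b) (sym wj)) h) = suc i , hi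

module Embedding (k m r : ℕ) where

  points : Vec (Fin m) k → Fin k × Fin m → Bool
  points a (i , j) = does (lookup a i Fin.≟ j)

  reads : Vec (Vec Bool m) k → Fin k × Fin m → Bool
  reads b (i , j) = lookup (lookup b i) j

  -- The last `r` positions are padding that lies in neither set, so that every `n` of at least
  -- `k * m` is covered.
  onCells : (Fin k × Fin m → Bool) → Fin (k * m + r) → Bool
  onCells f p = [ (λ q → f (remQuot m q)) , (λ _ → false) ]′ (splitAt (k * m) p)

  onCells-combine : ∀ f i j → onCells f (Fin.combine i j ↑ˡ r) ≡ f (i , j)
  onCells-combine f i j =
    trans (cong [ (λ q → f (remQuot m q)) , (λ _ → false) ]′ (splitAt-↑ˡ (k * m) (Fin.combine i j) r))
          (cong f (remQuot-combine i j))

  -- Alice's set has exactly one point in each block, so the two sets meet exactly when some pointer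
  -- selects a bit set by Bob.
  DISJ-hits : ∀ a b →
    DISJ (k * m + r) (merge (sides (k * m + r)) (aliceInput (onCells (points a)))
                                                (bobInput (onCells (reads b))))
    ≡ hits a b
  DISJ-hits a b = ⇔→≡ (mk⇔ disj⇒hits hits⇒disj)
    where
    meet : Fin (k * m + r) → Bool
    meet p = onCells (points a) p ∧ onCells (reads b) p

    disj⇒hits : OR meet ≡ true → hits a b ≡ true
    disj⇒hits h with p , hp ← OR⁻ meet h with splitAt (k * m) p
    ... | inj₁ q with lookup a (proj₁ (remQuot {k} m q)) Fin.≟ proj₂ (remQuot {k} m q)
    ...   | yes eq = hits⁺ a b (proj₁ (remQuot {k} m q))
                       (trans (cong (lookup (lookup b (proj₁ (remQuot {k} m q)))) eq) hp)

    hits⇒disj : hits a b ≡ true → OR meet ≡ true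
    hits⇒disj h with i , hi ← hits⁻ a b h = OR⁺ meet (Fin.combine i (lookup a i) ↑ˡ r) met
      where
      met : meet (Fin.combine i (lookup a i) ↑ˡ r) ≡ true
      met = trans (cong₂ _∧_ (onCells-combine (points a) i (lookup a i))
                             (onCells-combine (reads b) i (lookup a i)))
                  (cong₂ _∧_ (dec-true (lookup a i Fin.≟ lookup a i) refl) hi)

-- The protocol of linear size

fromℚ : ℚ → ℝ
fromℚ x = record
  { Lower           = ℚ._< x
  ; Upper           = x ℚ.<_
  ; lower-inhabited = x ℚ.- 1ℚ , below
  ; upper-inhabited = x ℚ.+ 1ℚ , above
  ; lower-rounded   = λ q → mk⇔ (λ q<x → ℚ.<-dense q<x) (λ (r , q<r , r<x) → ℚ.<-trans q<r r<x)
  ; upper-rounded   = λ q → mk⇔ (λ x<q → let (r , x<r , r<q) = ℚ.<-dense x<q in r , r<q , x<r)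
                                (λ (r , r<q , x<r) → ℚ.<-trans x<r r<q)
  ; disjoint        = λ q (q<x , x<q) → ℚ.<-asym q<x x<q
  ; located         = located
  }
  where
  below : x ℚ.- 1ℚ ℚ.< x
  below = subst (x ℚ.- 1ℚ ℚ.<_) (ℚ.+-identityʳ x) (ℚ.+-monoʳ-< x (from-yes (ℚ.- 1ℚ ℚ.<? 0ℚ)))
  above : x ℚ.< x ℚ.+ 1ℚ
  above = subst (ℚ._< x ℚ.+ 1ℚ) (ℚ.+-identityʳ x) (ℚ.+-monoʳ-< x (from-yes (0ℚ ℚ.<? 1ℚ)))
  located : ∀ {q r} → q ℚ.< r → q ℚ.< x ⊎ x ℚ.< r
  located {q} q<r with q ℚ.<? x
  ... | yes q<x = inj₁ q<x
  ... | no  q≮x = inj₂ (ℚ.≤-<-trans (ℚ.≮⇒≥ q≮x) q<r)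

fromℚ-> : ∀ {x y} → y ℚ.< x → fromℚ x >ᴿ fromℚ y
fromℚ-> y<x = ℚ.<-dense y<x

fromℚ-≯ : ∀ {x y} → x ℚ.≤ y → ¬ (fromℚ x >ᴿ fromℚ y)
fromℚ-≯ x≤y (q , y<q , q<x) = ℚ.<-irrefl refl (ℚ.<-trans y<q (ℚ.<-≤-trans q<x x≤y))

bit : Bool → ℝ
bit true  = fromℚ 1ℚ
bit false = fromℚ 0ℚ

-- For bits, `x > 1 - y` only when both are 1, so the answer 1 ends the protocol. The recursion is
-- on `t` with `n` fixed, since the inputs range over all `n` positions; `ι` lists those not yet
-- scanned.
scan : ∀ {n} t → (Fin t → Fin n) → RealProtocol (sides n)
scan zero    ι = leaf false
scan (suc t) ι = ask (λ x → bit (x (inj₁ (ι zero)) refl))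
                     (λ y → bit (not (y (inj₂ (ι zero)) refl)))
                     (leaf true) (scan t (λ i → ι (suc i)))

scan-size : ∀ {n} t (ι : Fin t → Fin n) → size (scan t ι) ≡ 1 + 2 * t
scan-size zero    ι = refl
scan-size (suc t) ι rewrite scan-size t (λ i → ι (suc i)) = cong suc (sym (+-suc (suc t) _))

scan-outputs : ∀ {n} t (ι : Fin t → Fin n) x y →
  Outputs (scan t ι) x y (OR (λ i → x (inj₁ (ι i)) refl ∧ y (inj₂ (ι i)) refl))
scan-outputs zero    ι x y = at-leaf
scan-outputs (suc t) ι x y with x (inj₁ (ι zero)) refl in ex | y (inj₂ (ι zero)) refl in ey
... | true  | true  = on-1 (subst₂ (λ b c → bit b >ᴿ bit (not c)) (sym ex) (sym ey)
                             (fromℚ-> (from-yes (0ℚ ℚ.<? 1ℚ)))) at-leaf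
... | true  | false = on-0 (subst₂ (λ b c → ¬ (bit b >ᴿ bit (not c))) (sym ex) (sym ey)
                             (fromℚ-≯ ℚ.≤-refl))
                             (scan-outputs t _ x y)
... | false | true  = on-0 (subst₂ (λ b c → ¬ (bit b >ᴿ bit (not c))) (sym ex) (sym ey)
                             (fromℚ-≯ ℚ.≤-refl))
                             (scan-outputs t _ x y)
... | false | false = on-0 (subst₂ (λ b c → ¬ (bit b >ᴿ bit (not c))) (sym ex) (sym ey)
                             (fromℚ-≯ (from-yes (0ℚ ℚ.≤? 1ℚ))))
                             (scan-outputs t _ x y)

upper-bound : ∀ n → n ≥ 1 →
  Σ[ P ∈ RealProtocol (sides n) ] (Computes (sides n) P (DISJ n) × size P ≤ 3 * n)
upper-bound n n≥1 = scan n (λ i → i) , scan-outputs n (λ i → i) ,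
  ≤-trans (≤-reflexive (scan-size n (λ i → i))) (+-monoˡ-≤ (2 * n) n≥1)

-- Choice of the parameters

suc≤2^ : ∀ a → 1 + a ≤ 2 ^ a
suc≤2^ zero    = ≤-refl
suc≤2^ (suc a) = ≤-trans (+-mono-≤ (m^n>0 2 a) (suc≤2^ a)) (≤-reflexive (n+n≡2*n (2 ^ a)))

module _ (a : ℕ) where

  open ≤-Reasoning

  private
    -- 4 * d ≤ m needs m of order k² log m, so m = 2⁸ k³ absorbs the logarithm.
    k L m τ d : ℕ
    k = 2 ^ a
    L = 3 * a + 8
    m = 2 ^ L
    τ = L * k + (2 + (k + k))
    d = 4 * (k * τ)

  τ-covers : m ^ k * 2 ^ (2 + (k + k)) ≡ 2 ^ τ
  τ-covers = trans (cong (_* 2 ^ (2 + (k + k))) (^-*-assoc 2 L k))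
                   (sym (^-distribˡ-+-* 2 (L * k) (2 + (k + k))))

  -- As `1 ≤ k`, the sum `τ` is at most `(3 * a + 12) * k`, and `1 + a ≤ 2 ^ a` bounds `3 * a + 12`
  -- by `16 * k`. Hence `4 * d` is at most `2 ^ 8 * k ^ 3`, which is `m`.
  m-large : 4 * d ≤ m
  m-large = begin
    4 * (4 * (k * (L * k + (2 + (k + k)))))
      ≤⟨ *-monoʳ-≤ 4 (*-monoʳ-≤ 4 (*-monoʳ-≤ k
           (+-monoʳ-≤ (L * k) (+-monoˡ-≤ (k + k) (*-monoʳ-≤ 2 (m^n>0 2 a)))))) ⟩
    4 * (4 * (k * (L * k + (2 * k + (k + k)))))
      ≡⟨ collect a k ⟩
    16 * (k * k * (3 * a + 12))
      ≤⟨ *-monoʳ-≤ 16 (*-monoʳ-≤ (k * k) linear) ⟩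
    16 * (k * k * (16 * k))
      ≡⟨ powers ⟩
    m ∎
    where
    collect : ∀ a k → 4 * (4 * (k * ((3 * a + 8) * k + (2 * k + (k + k))))) ≡ 16 * (k * k * (3 * a + 12))
    collect = solve-∀
    linear : 3 * a + 12 ≤ 16 * k
    linear = begin
      3 * a + 12       ≤⟨ +-monoˡ-≤ 12 (*-monoˡ-≤ a (m≤m+n 3 13)) ⟩
      16 * a + 12      ≤⟨ +-monoʳ-≤ (16 * a) (m≤m+n 12 4) ⟩
      16 * a + 16      ≡⟨ factor a ⟩
      16 * (1 + a)     ≤⟨ *-monoʳ-≤ 16 (suc≤2^ a) ⟩
      16 * k           ∎
      where
      factor : ∀ a → 16 * a + 16 ≡ 16 * (1 + a)
      factor = solve-∀
    powers : 16 * (k * k * (16 * k)) ≡ m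
    powers = trans (reorder k) (trans (cong (_* 2 ^ 8) (trans (cong (λ e → k * e) (sym (^-distribˡ-+-* 2 a a)))
               (trans (sym (^-distribˡ-+-* 2 a (a + a))) (cong (2 ^_) (triple a)))))
               (sym (^-distribˡ-+-* 2 (3 * a) 8)))
      where
      reorder : ∀ k → 16 * (k * k * (16 * k)) ≡ k * (k * k) * 256
      reorder = solve-∀
      triple : ∀ a → a + (a + a) ≡ 3 * a
      triple = solve-∀

  rounds-DISJ : ∀ n → 2 ^ (4 * a + 8) ≤ n → (P : RealProtocol (sides n)) →
                Computes (sides n) P (DISJ n) → 2 ^ a ≤ rounds P
  rounds-DISJ n n-large P computes with m≤n⇒∃[o]m+o≡n (≤-trans (≤-reflexive blocks) n-large)
    where
    blocks : k * m ≡ 2 ^ (4 * a + 8)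
    blocks = trans (sym (^-distribˡ-+-* 2 a L)) (cong (2 ^_) (exponent a))
      where
      exponent : ∀ a → a + (3 * a + 8) ≡ 4 * a + 8
      exponent = solve-∀
  ... | r , refl = Adversary.lower-bound m {{m^n≢0 2 L}} k τ d ≤-refl m-large (≤-reflexive τ-covers)
    P (λ u → aliceInput (onCells (points u))) (λ b → bobInput (onCells (reads b)))
    (λ u b → subst (Outputs P _ _) (DISJ-hits u b) (computes _ _))
    where open Embedding k m r

-- Searches downwards for the largest `a` that fits, which places `n` within a factor 16 of
-- `2 ^ (4 * a + 8)`; `t` only bounds the search.
scale : ∀ n t → 2 ^ 8 ≤ n → n < 2 ^ (4 * t + 8) →
        ∃[ a ] 2 ^ (4 * a + 8) ≤ n × n < 2 ^ (4 * suc a + 8)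
scale n zero    n≥ n< = contradiction n≥ (<⇒≱ n<)
scale n (suc t) n≥ n< with n <? 2 ^ (4 * t + 8)
... | yes n<′ = scale n t n≥ n<′
... | no  n≮  = t , ≮⇒≥ n≮ , n<

-- With `k = 2 ^ a`, `n` is below `2 ^ 12 * k ^ 4` and its logarithm is at most
-- `4 * a + 12 ≤ 12 * k`. A fifth factor `k` thus absorbs the logarithm, and `k` is at most the
-- number of rounds.
lower-bound-at : ∀ a n → 2 ^ (4 * a + 8) ≤ n → n < 2 ^ (4 * suc a + 8) →
  (P : RealProtocol (sides n)) → Computes (sides n) P (DISJ n) →
  n * ⌈log₂ n ⌉ ≤ 2 ^ 12 * 12 * rounds P ^ 5
lower-bound-at a n low high P computes = begin
  n * ⌈log₂ n ⌉
    ≤⟨ *-mono-≤ (<⇒≤ high) (≤-trans (⌈log₂⌉-mono-≤ (<⇒≤ high))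
                              (≤-reflexive (⌈log₂2^n⌉≡n (4 * suc a + 8)))) ⟩
  2 ^ (4 * suc a + 8) * (4 * suc a + 8)
    ≤⟨ *-mono-≤ (≤-reflexive (powers a)) (log-small a) ⟩
  2 ^ 12 * (2 ^ a) ^ 4 * (12 * 2 ^ a)
    ≡⟨ regroup (2 ^ 12) 12 (2 ^ a) ((2 ^ a) ^ 4) ⟩
  2 ^ 12 * 12 * (2 ^ a) ^ 5
    ≤⟨ *-monoʳ-≤ (2 ^ 12 * 12) (^-monoˡ-≤ 5 (rounds-DISJ a n low P computes)) ⟩
  2 ^ 12 * 12 * rounds P ^ 5 ∎
  where
  open ≤-Reasoning
  powers : ∀ a → 2 ^ (4 * suc a + 8) ≡ 2 ^ 12 * (2 ^ a) ^ 4
  powers a = trans (cong (2 ^_) (exponent a)) (trans (^-distribˡ-+-* 2 12 (a * 4))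
               (cong (2 ^ 12 *_) (sym (^-*-assoc 2 a 4))))
    where
    exponent : ∀ a → 4 * suc a + 8 ≡ 12 + a * 4
    exponent = solve-∀
  log-small : ∀ a → 4 * suc a + 8 ≤ 12 * 2 ^ a
  log-small a = ≤-trans (≤-trans (≤-reflexive (expand a)) (m≤m+n (4 * a + 12) (8 * a)))
    (≤-trans (≤-reflexive (factor a)) (*-monoʳ-≤ 12 (suc≤2^ a)))
    where
    expand : ∀ a → 4 * suc a + 8 ≡ 4 * a + 12
    expand = solve-∀
    factor : ∀ a → 4 * a + 12 + 8 * a ≡ 12 * (1 + a)
    factor = solve-∀
  regroup : ∀ c t x y → c * y * (t * x) ≡ c * t * (x * y)
  regroup = solve-∀

lower-bound : ∀ n → n ≥ 2 ^ 8 → (P : RealProtocol (sides n)) → Computes (sides n) P (DISJ n) →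
              n * ⌈log₂ n ⌉ ≤ 2 ^ 12 * 12 * rounds P ^ 5
lower-bound n n≥ P computes =
  let (a , low , high) = scale n n n≥ (≤-trans (suc≤2^ n)
        (^-monoʳ-≤ 2 (≤-trans (m≤n*m n 4) (m≤m+n (4 * n) 8))))
  in lower-bound-at a n low high P computes

theorem6p4 : Σ[ π ∈ ((n : ℕ) → Partition (Var n)) ]
    (∃[ C ] ∃[ N ] ∀ n → n ≥ N →
    Σ[ P ∈ RealProtocol (π n) ] (Computes (π n) P (DISJ n) × size P ≤ C * n))
    ×
    (∃[ K ] ∃[ N ] ∀ n → n ≥ N →
    (P : RealProtocol (π n)) → Computes (π n) P (DISJ n) →
    n * ⌈log₂ n ⌉ ≤ K * rounds P ^ 5)
theorem6p4 = sides , (3 , 1 , upper-bound) , (2 ^ 12 * 12 , 2 ^ 8 , lower-bound)
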